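{- (a) For any tree $G=(V,E)$ on $n$ vertices and any labelling $L$ of $G$ that satisfies the property TC on $G$, the cost of $L$ satisfies $c(L)\ge 2n-3$. (b) Given any connected undirected graph $G=(V,E)$ on $n$ vertices, one can design a labelling $L$ of $G$ of cost $c(L)=2(n-1)$ that satisfies the property TC on $G$; such an $L$ can be computed in polynomial time.
   Context: A labelling of a graph $G=(V,E)$ is an assignment $L=\{L_e\subseteq\mathbb{N}^*:e\in E\}$ of sets of positive integers (labels) to edges (a set $L_e$ may be empty); $G(L)=(V,E,L)$ is the resulting temporal graph. The cost of $L$ is $c(L)=\sum_{e\in E}|L_e|$. A $(u,v)$-journey in $G(L)$ is a sequence $(u,u_1,l_1),(u_1,u_2,l_2),\ldots,(u_{k-1},v,l_k)$ in which each consecutive pair of vertices forms an edge $e$ of $G$ with the corresponding label in $L_e$, and $l_1<l_2<\cdots<l_k$ (undirected edges may be traversed in either direction). $L$ satisfies TC on $G$ (i.e. $G(L)$ is temporally connected) if for every ordered pair of distinct vertices $u,v\in V$ there is a $(u,v)$-journey in $G(L)$. -}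

module Defs where

open import Data.Bool.Base using (Bool; true; false; T)
open import Data.Bool.Properties using (T?)
open import Data.Fin.Base using (Fin; zero; toℕ; _<_)
open import Data.Fin.Properties using (_<?_)
open import Data.List.Base using (List; []; _∷_; _∷ʳ_; length; map; mapMaybe; cartesianProduct; allFin; tabulate)
open import Data.List.Membership.Propositional using (_∈_)
open import Data.List.Relation.Unary.Linked using (Linked)
open import Data.List.Relation.Unary.Unique.Propositional using (Unique)
open import Data.Maybe.Base using (Maybe; just; nothing)
open import Data.Nat.Base as ℕ using (ℕ; suc; NonZero; _+_; _*_; _^_; _≤_)
open import Data.Nat.ListAction using (sum)
open import Data.Product.Base using (∃-syntax; _×_; _,_)
open import Data.Sum.Base using (_⊎_)
open import Data.Vec.Base using (Vec; lookup; replicate; _[_]≔_) renaming (_∷_ to _∷ᵛ_)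
open import Function.Bundles using (_⇔_)
open import Level using (0ℓ)
open import Relation.Binary.Construct.Closure.ReflexiveTransitive using (Star)
open import Relation.Binary.Core using (Rel)
open import Relation.Binary.Definitions using (Irreflexive; Symmetric)
open import Relation.Binary.PropositionalEquality.Core using (_≡_; _≢_)
open import Relation.Nullary.Decidable.Core using (yes; no)
open import Relation.Nullary.Negation.Core using (¬_)
open import Relation.Unary using (Pred)

record Graph (n : ℕ) : Set where
  field
    adjacent : Fin n → Fin n → Bool

  Adj : Rel (Fin n) 0ℓ
  Adj u v = T (adjacent u v)

  field
    adj-sym    : Symmetric Adj
    adj-irrefl : Irreflexive _≡_ Adj

open Graph public

-- An undirected edge is represented by its endpoints in increasing order,
-- so that {u , v} occurs once.  The proofs are irrelevant, so an edge is
-- determined by its endpoints.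
record Edge {n} (G : Graph n) : Set where
  constructor edge
  field
    lo hi    : Fin n
    .lo<hi   : lo < hi
    .lo-hi   : Adj G lo hi

open Edge public

edges : ∀ {n} (G : Graph n) → List (Edge G)
edges {n} G = mapMaybe edge? (cartesianProduct (allFin n) (allFin n))
  where
  edge? : Fin n × Fin n → Maybe (Edge G)
  edge? (u , v) with u <? v | T? (adjacent G u v)
  ... | yes u<v | yes uv = just (edge u v u<v uv)
  ... | _       | _      = nothing

Joins : ∀ {n} {G : Graph n} → Edge G → Fin n → Fin n → Set
Joins e u v = (u ≡ lo e × v ≡ hi e) ⊎ (u ≡ hi e × v ≡ lo e)

Connected : ∀ {n} → Graph n → Set
Connected G = ∀ u v → Star (Adj G) u v

-- A cycle s , v₁ , … , vₖ , s through k + 1 ≥ 3 distinct vertices.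
Cycle : ∀ {n} → Graph n → Set
Cycle G = ∃[ s ] ∃[ vs ] 2 ≤ length vs × Unique (s ∷ vs) × Linked (Adj G) (s ∷ vs ∷ʳ s)

Tree : ∀ {n} → Graph n → Set
Tree G = Connected G × ¬ Cycle G

record Labelling {n} (G : Graph n) : Set₁ where
  field
    Label    : Edge G → Pred ℕ 0ℓ
    positive : ∀ {e l} → Label e l → NonZero l

open Labelling public

HasSize : Pred ℕ 0ℓ → ℕ → Set
HasSize P k = ∃[ xs ] Unique xs × (∀ x → x ∈ xs ⇔ P x) × length xs ≡ k

-- HasCost L c says that all label sets are finite and c(L) = c.  A labelling
-- with an infinite label set has infinite cost, i.e. no cost in ℕ, so a lower
-- bound on every c with HasCost L c is a lower bound on c(L) in ℕ ∪ {∞}.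
HasCost : ∀ {n} {G : Graph n} → Labelling G → ℕ → Set
HasCost {G = G} L c =
  ∃[ size ] (∀ e → HasSize (Label L e) (size e)) × sum (map size (edges G)) ≡ c

TimeEdge : ∀ {n} {G : Graph n} → Labelling G → Fin n → Fin n → ℕ → Set
TimeEdge {G = G} L u v l = ∃[ e ] Joins {G = G} e u v × Label L e l

-- Journey L l u v is the type of (u,v)-journeys whose first label is l.
data Journey {n} {G : Graph n} (L : Labelling G) : ℕ → Fin n → Fin n → Set where
  [_]    : ∀ {u v l} → TimeEdge L u v l → Journey L l u v
  _∷⟨_⟩_ : ∀ {u w v l m} → TimeEdge L u w l → l ℕ.< m → Journey L m w v → Journey L l u v

TC : ∀ {n} {G : Graph n} → Labelling G → Set
TC L = ∀ u v → u ≢ v → ∃[ l ] Journey L l u v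

-- The model of computation is Jones's WHILE language over binary trees
-- ("Computability and Complexity from a Programming Perspective") with its
-- unit-cost time measure, in which polynomial time is that of Turing machines.
-- A tree built in t steps may have exponential size through sharing, but its
-- depth exceeds that of the input by at most t; so a list of triples of unary
-- numerals, as used below for the output, has polynomial size.

infixr 6 _∙_

data 𝔻 : Set where
  nil : 𝔻
  _∙_ : 𝔻 → 𝔻 → 𝔻

∥_∥ : 𝔻 → ℕ
∥ nil ∥   = 1
∥ a ∙ b ∥ = 1 + ∥ a ∥ + ∥ b ∥

head tail : 𝔻 → 𝔻
head nil     = nil
head (a ∙ _) = a
tail nil     = nil
tail (_ ∙ b) = b

data Expr (k : ℕ) : Set where
  var   : Fin k → Expr k
  `nil  : Expr k
  `cons : Expr k → Expr k → Expr k
  `hd   : Expr k → Expr k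
  `tl   : Expr k → Expr k

infix  5 _≔_
infixr 4 _⨟_

data Cmd (k : ℕ) : Set where
  _≔_           : Fin k → Expr k → Cmd k
  _⨟_           : Cmd k → Cmd k → Cmd k
  if_then_else_ : Expr k → Cmd k → Cmd k → Cmd k
  while_loop_   : Expr k → Cmd k → Cmd k

Store : ℕ → Set
Store k = Vec 𝔻 k

⟦_⟧ : ∀ {k} → Expr k → Store k → 𝔻
⟦ var x ⟧     σ = lookup σ x
⟦ `nil ⟧      σ = nil
⟦ `cons E F ⟧ σ = ⟦ E ⟧ σ ∙ ⟦ F ⟧ σ
⟦ `hd E ⟧     σ = head (⟦ E ⟧ σ)
⟦ `tl E ⟧     σ = tail (⟦ E ⟧ σ)

timeᴱ : ∀ {k} → Expr k → ℕ
timeᴱ (var x)     = 1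
timeᴱ `nil        = 1
timeᴱ (`cons E F) = 1 + timeᴱ E + timeᴱ F
timeᴱ (`hd E)     = 1 + timeᴱ E
timeᴱ (`tl E)     = 1 + timeᴱ E

-- ⟨ C , σ ⟩⇓ τ in-time t : started in store σ, C halts in store τ after t steps.
-- As a truth value, nil is false and every other tree is true.
infix 3 ⟨_,_⟩⇓_in-time_

data ⟨_,_⟩⇓_in-time_ {k} : Cmd k → Store k → Store k → ℕ → Set where

  assign : ∀ {x E σ} →
           ⟨ x ≔ E , σ ⟩⇓ σ [ x ]≔ ⟦ E ⟧ σ in-time (1 + timeᴱ E)

  seq : ∀ {C D σ ρ τ s t} →
        ⟨ C , σ ⟩⇓ ρ in-time s →
        ⟨ D , ρ ⟩⇓ τ in-time t →
        ⟨ C ⨟ D , σ ⟩⇓ τ in-time (s + t)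

  if-true : ∀ {E C D σ τ t} →
            ⟦ E ⟧ σ ≢ nil →
            ⟨ C , σ ⟩⇓ τ in-time t →
            ⟨ if E then C else D , σ ⟩⇓ τ in-time (1 + timeᴱ E + t)

  if-false : ∀ {E C D σ τ t} →
             ⟦ E ⟧ σ ≡ nil →
             ⟨ D , σ ⟩⇓ τ in-time t →
             ⟨ if E then C else D , σ ⟩⇓ τ in-time (1 + timeᴱ E + t)

  while-true : ∀ {E C σ ρ τ s t} →
               ⟦ E ⟧ σ ≢ nil →
               ⟨ C , σ ⟩⇓ ρ in-time s →
               ⟨ while E loop C , ρ ⟩⇓ τ in-time t →
               ⟨ while E loop C , σ ⟩⇓ τ in-time (1 + timeᴱ E + s + t)

  while-false : ∀ {E C σ} →
                ⟦ E ⟧ σ ≡ nil →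
                ⟨ while E loop C , σ ⟩⇓ σ in-time (1 + timeᴱ E)

-- Variable 0 holds the input on entry and the output on exit; the other
-- variables are initially nil.
record Program : Set where
  field
    extraVars : ℕ
    body      : Cmd (suc extraVars)

open Program public

-- p maps the input d to the output r within the given number of steps.
Computes_from_to_within_ : Program → 𝔻 → 𝔻 → ℕ → Set
Computes p from d to r within bound =
  ∃[ τ ] ∃[ t ] (⟨ body p , d ∷ᵛ replicate (extraVars p) nil ⟩⇓ τ in-time t)
              × lookup τ zero ≡ r
              × t ≤ bound

encodeBool : Bool → 𝔻
encodeBool false = nil
encodeBool true  = nil ∙ nil

encodeℕ : ℕ → 𝔻
encodeℕ ℕ.zero  = nil
encodeℕ (suc m) = nil ∙ encodeℕ m

encodeList : ∀ {A : Set} → (A → 𝔻) → List A → 𝔻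
encodeList f []       = nil
encodeList f (x ∷ xs) = f x ∙ encodeList f xs

encodeGraph : ∀ {n} → Graph n → 𝔻
encodeGraph G =
  encodeList (encodeList encodeBool) (tabulate λ u → tabulate λ v → adjacent G u v)

encodeTriple : ∀ {n} → Fin n × Fin n × ℕ → 𝔻
encodeTriple (u , v , l) = encodeℕ (toℕ u) ∙ encodeℕ (toℕ v) ∙ encodeℕ l

-- The tree r describes L as a list of triples (u , v , l), each saying that the
-- edge {u , v} carries the label l; the endpoints may come in either order.
_Describes_ : ∀ {n} {G : Graph n} → 𝔻 → Labelling G → Set
_Describes_ {G = G} r L =
  ∃[ ts ] r ≡ encodeList encodeTriple ts
        × (∀ u v l → (u , v , l) ∈ ts → TimeEdge L u v l)
        × (∀ (e : Edge G) l → Label L e l → (lo e , hi e , l) ∈ ts ⊎ (hi e , lo e , l) ∈ ts)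

{-# OPTIONS --safe #-}

-- (a) In a tree, removing an edge e separates its ends, so a journey between
-- the two sides has to use e.  Hence every edge carries a label.  If two edges
-- e ≠ f carried a single label each, take the end a of e and the end d of f
-- that are farthest apart: the journey from a to d forces the label of e to be
-- smaller than that of f, and the journey from d to a forces the opposite.  So
-- at most one of the (at least n − 1) edges has fewer than two labels.
--
-- (b) Grow a spanning tree from a root by graph search, giving the i-th edge
-- the labels n − i and n + i.  A new vertex first uses the smaller label to
-- enter the tree built so far, and is reached through the larger one.
module Submission where

open import Defs
open import Data.Bool.Base using (Bool; true; false; T)
open import Data.Bool.Properties using (T?)
open import Data.Empty using (⊥)
import Data.Empty.Irrelevant as Irrelevant
open import Data.Fin using (#_)
open import Data.Fin.Base as Fin using (Fin; toℕ; fromℕ<)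
import Data.Fin.Properties as Fin
open import Data.List.Base
  using (List; []; _∷_; _∷ʳ_; _++_; length; map; filter; mapMaybe; cartesianProduct; allFin; tabulate)
import Data.List.Membership.DecPropositional as DecMembership
open import Data.List.Membership.Propositional using (_∈_; _∉_)
open import Data.List.Membership.Propositional.Properties
  using (∈-allFin; ∈-cartesianProduct⁺; ∈-filter⁺; ∈-filter⁻; ∈-map⁺; ∈-map⁻)
open import Data.List.Properties using (filter-all; length-map; length-tabulate; ++-identityʳ)
open import Data.List.Relation.Binary.Permutation.Propositional using (_↭_; ↭-sym)
open import Data.List.Relation.Binary.Permutation.Propositional.Properties
  using (shift; ∈-resp-↭; ↭-length)
open import Data.List.Relation.Unary.All as All using (All; []; _∷_)
import Data.List.Relation.Unary.All.Properties as All
open import Data.List.Relation.Unary.AllPairs using (AllPairs; []; _∷_)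
import Data.List.Relation.Unary.AllPairs.Properties as AllPairs
open import Data.List.Relation.Unary.Any using (here; there)
open import Data.List.Relation.Unary.Linked using (Linked; [-]; _∷_)
open import Data.List.Relation.Unary.Unique.Propositional using (Unique)
import Data.List.Relation.Unary.Unique.Propositional.Properties as Unique
open import Data.Maybe.Base using (Maybe; just; nothing)
open import Data.Nat.Base
  using (ℕ; zero; suc; pred; NonZero; >-nonZero; _+_; _*_; _∸_; _^_; _≤_; _<_; _≥_; z≤n; s≤s)
open import Data.Nat.ListAction using (sum)
open import Data.Nat.Properties
open import Data.Product.Base using (_×_; _,_; ∃-syntax; proj₁; proj₂)
open import Data.Sum.Base as Sum using (_⊎_; inj₁; inj₂)
open import Data.Vec.Base using (replicate; _[_]≔_; []; _∷_)
open import Function.Base using (_∘_; id; _$_)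
open import Function.Bundles using (module Equivalence; mk⇔)
open import Level using (0ℓ)
open import Relation.Binary.Construct.Closure.ReflexiveTransitive as Star using (Star; ε; _◅_; _◅◅_)
open import Relation.Binary.Core using (Rel)
open import Relation.Binary.Definitions using (DecidableEquality; Symmetric; tri<; tri≈; tri>)
open import Relation.Binary.PropositionalEquality
  using (_≡_; _≢_; refl; sym; trans; cong; cong₂; subst; ≢-sym)
open import Relation.Nullary.Decidable using (Dec; yes; no; ¬?; _×-dec_; _⊎-dec_)
open import Relation.Nullary.Negation using (¬_; contradiction)

-- The lower bound for trees

module _ {A B : Set} {f : A → Maybe B} where

  ∈-mapMaybe⁺ : ∀ {xs x y} → x ∈ xs → f x ≡ just y → y ∈ mapMaybe f xs
  ∈-mapMaybe⁺ {x ∷ _} (here refl) eq with f x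
  ∈-mapMaybe⁺ {x ∷ _} (here refl) refl | just _ = here refl
  ∈-mapMaybe⁺ {x ∷ _} (there p) eq with f x
  ... | just _  = there (∈-mapMaybe⁺ p eq)
  ... | nothing = ∈-mapMaybe⁺ p eq

  ∈-mapMaybe⁻ : ∀ xs {y} → y ∈ mapMaybe f xs → ∃[ x ] x ∈ xs × f x ≡ just y
  ∈-mapMaybe⁻ (x ∷ xs) y∈ with f x in eq
  ∈-mapMaybe⁻ (x ∷ xs) (here refl) | just _ = x , here refl , eq
  ∈-mapMaybe⁻ (x ∷ xs) (there y∈)  | just _ with ∈-mapMaybe⁻ xs y∈
  ... | z , z∈ , fz = z , there z∈ , fz
  ∈-mapMaybe⁻ (x ∷ xs) y∈ | nothing with ∈-mapMaybe⁻ xs y∈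
  ... | z , z∈ , fz = z , there z∈ , fz

  mapMaybe-unique : (∀ {x x′ y} → f x ≡ just y → f x′ ≡ just y → x ≡ x′) →
                    ∀ {xs} → Unique xs → Unique (mapMaybe f xs)
  mapMaybe-unique inj {[]}     []       = []
  mapMaybe-unique inj {x ∷ xs} (x∉ ∷ u) with f x in eq
  ... | nothing = mapMaybe-unique inj u
  ... | just y  = All.tabulate fresh ∷ mapMaybe-unique inj u
    where
    fresh : ∀ {z} → z ∈ mapMaybe f xs → y ≢ z
    fresh z∈ refl with ∈-mapMaybe⁻ xs z∈
    ... | x′ , x′∈ , fx′ = All.lookup x∉ x′∈ (inj eq fx′)

module _ {n : ℕ} {G : Graph n} where

  _≟ᴱ_ : DecidableEquality (Edge G)
  edge u v _ _ ≟ᴱ edge u′ v′ _ _ with u Fin.≟ u′ | v Fin.≟ v′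
  ... | yes refl | yes refl = yes refl
  ... | no u≢u′  | _        = no λ { refl → u≢u′ refl }
  ... | _        | no v≢v′  = no λ { refl → v≢v′ refl }

  lo≢hi : (e : Edge G) → lo e ≢ hi e
  lo≢hi (edge u .u u<u _) refl = Irrelevant.⊥-elim (Fin.<-irrefl refl u<u)

  joins-sym : (e : Edge G) → Symmetric (Joins e)
  joins-sym e (inj₁ (p , q)) = inj₂ (q , p)
  joins-sym e (inj₂ (p , q)) = inj₁ (q , p)

  joins-unique : ∀ (e f : Edge G) {u v} → Joins e u v → Joins f u v → e ≡ f
  joins-unique (edge _ _ _ _) (edge _ _ _ _) (inj₁ (refl , refl)) (inj₁ (refl , refl)) = refl
  joins-unique (edge _ _ _ _) (edge _ _ _ _) (inj₂ (refl , refl)) (inj₂ (refl , refl)) = refl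
  joins-unique (edge _ _ p _) (edge _ _ q _) (inj₁ (refl , refl)) (inj₂ (refl , refl)) =
    Irrelevant.⊥-elim (Fin.<-asym p q)
  joins-unique (edge _ _ p _) (edge _ _ q _) (inj₂ (refl , refl)) (inj₁ (refl , refl)) =
    Irrelevant.⊥-elim (Fin.<-asym p q)

  -- The adjacency proof stored in an edge is irrelevant, so a usable one is recovered by deciding
  -- adjacency again.
  joins⇒adj : ∀ (e : Edge G) {u v} → Joins e u v → Adj G u v
  joins⇒adj (edge u v _ uv) j with T? (adjacent G u v)
  joins⇒adj (edge u v _ uv) (inj₁ (refl , refl)) | yes p = p
  joins⇒adj (edge u v _ uv) (inj₂ (refl , refl)) | yes p = adj-sym G p
  joins⇒adj (edge u v _ uv) j                    | no ¬p = Irrelevant.⊥-elim (¬p uv)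

  adj⇒joins : ∀ {u v} → Adj G u v → ∃[ e ] Joins {G = G} e u v
  adj⇒joins {u} {v} uv with Fin.<-cmp u v
  ... | tri< u<v _ _ = edge u v u<v uv , inj₁ (refl , refl)
  ... | tri≈ _ u≡v _ = contradiction uv (adj-irrefl G u≡v)
  ... | tri> _ _ v<u = edge v u v<u (adj-sym G uv) , inj₂ (refl , refl)

-- The function whose values are collected by edges is local to it, hence this
-- detour to give it a name.
edges-mapMaybe : ∀ {n} (G : Graph n) →
  ∃[ f ] edges G ≡ mapMaybe f (cartesianProduct (allFin n) (allFin n))
edges-mapMaybe G = _ , refl

module _ {n : ℕ} (G : Graph n) where

  edge? : Fin n × Fin n → Maybe (Edge G)
  edge? = proj₁ (edges-mapMaybe G)

  edge?-lo-hi : (e : Edge G) → edge? (lo e , hi e) ≡ just e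
  edge?-lo-hi (edge u v u<v uv) with u Fin.<? v | T? (adjacent G u v)
  ... | yes _  | yes _  = refl
  ... | no u≮v | _      = Irrelevant.⊥-elim (u≮v u<v)
  ... | yes _  | no ¬uv = Irrelevant.⊥-elim (¬uv uv)

  edge?-just : ∀ {x e} → edge? x ≡ just e → x ≡ (lo e , hi e)
  edge?-just {u , v} eq with u Fin.<? v | T? (adjacent G u v)
  edge?-just {u , v} refl | yes _ | yes _ = refl

  ∈-edges : (e : Edge G) → e ∈ edges G
  ∈-edges e = ∈-mapMaybe⁺ {f = edge?} (∈-cartesianProduct⁺ (∈-allFin (lo e)) (∈-allFin (hi e))) (edge?-lo-hi e)

  edges-unique : Unique (edges G)
  edges-unique = mapMaybe-unique {f = edge?} (λ p q → trans (edge?-just p) (sym (edge?-just q)))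
                   (Unique.cartesianProduct⁺ (Unique.allFin⁺ n) (Unique.allFin⁺ n))

-- Number of edges of a connected graph

module _ {A : Set} (_≟_ : DecidableEquality A) where

  length-filter-≢ : ∀ x {xs} → Unique xs → length xs ≤ suc (length (filter (λ y → ¬? (y ≟ x)) xs))
  length-filter-≢ x []                 = z≤n
  length-filter-≢ x {y ∷ ys} (y∉ ∷ u) with y ≟ x
  ... | yes refl = s≤s (≤-reflexive (cong length (sym (filter-all _ (All.map (_∘ sym) y∉)))))
  ... | no _     = s≤s (length-filter-≢ x u)

module _ {n : ℕ} {G : Graph n} where

  -- Adding an edge merges the colours of its endpoints, so it loses at most one colour.
  colouring : (es : List (Edge G)) →
    ∃[ colour ] (∀ {e} → e ∈ es → colour (lo e) ≡ colour (hi e))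
      × ∃[ cs ] Unique cs × (∀ {c : Fin n} → c ∈ cs → ∃[ v ] colour v ≡ c) × n ≤ length cs + length es
  colouring [] = id , (λ ()) , allFin n , Unique.allFin⁺ n , (λ {c} _ → c , refl)
               , ≤-reflexive (trans (sym (length-tabulate id)) (sym (+-identityʳ _)))
  colouring (e ∷ es) with colouring es
  ... | f , mono , cs , u , used , n≤ =
    -- The colour `a` is dropped from `cs` even if it equals `b`; the new edge pays for the loss.
    g , mono′ , filter ≢a? cs , Unique.filter⁺ ≢a? u , used′ ,
    (begin
      n                                           ≤⟨ n≤ ⟩
      length cs + length es                       ≤⟨ +-monoˡ-≤ (length es) (length-filter-≢ Fin._≟_ a u) ⟩
      suc (length (filter ≢a? cs)) + length es    ≡⟨ +-suc _ (length es) ⟨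
      length (filter ≢a? cs) + suc (length es)    ∎)
    where
    open ≤-Reasoning
    a b : Fin n
    a = f (lo e)
    b = f (hi e)
    ≢a? : (c : Fin n) → Dec (c ≢ a)
    ≢a? c = ¬? (c Fin.≟ a)
    merge : Fin n → Fin n
    merge c with c Fin.≟ a
    ... | yes _ = b
    ... | no  _ = c
    g : Fin n → Fin n
    g = merge ∘ f
    mono′ : ∀ {d} → d ∈ e ∷ es → g (lo d) ≡ g (hi d)
    mono′ (there d∈) = cong merge (mono d∈)
    mono′ (here refl) with a Fin.≟ a | b Fin.≟ a
    ... | yes _  | yes _ = refl
    ... | yes _  | no _  = refl
    ... | no a≢a | _     = contradiction refl a≢a
    used′ : ∀ {c} → c ∈ filter ≢a? cs → ∃[ v ] g v ≡ c
    used′ c∈ with ∈-filter⁻ ≢a? {xs = cs} c∈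
    ... | c∈cs , c≢a with used c∈cs
    ... | v , refl with f v Fin.≟ a in eq
    ...   | yes p = contradiction p c≢a
    ...   | no _  = v , merged
      where
      merged : g v ≡ f v
      merged rewrite eq = refl

  -- A colouring that agrees along every edge is constant on a connected graph, so at most one used
  -- colour is left after all edges have been added.
  connected⇒enough-edges : Connected G → n ≤ suc (length (edges G))
  connected⇒enough-edges conn with colouring (edges G)
  ... | f , mono , cs , u , used , n≤ = ≤-trans n≤ (+-monoˡ-≤ (length (edges G)) (single cs u used))
    where
    constant : ∀ {u v} → Star (Adj G) u v → f u ≡ f v
    constant ε = refl
    constant (uv ◅ vs) with adj⇒joins {G = G} uv
    ... | e , inj₁ (refl , refl) = trans (mono (∈-edges G e)) (constant vs)
    ... | e , inj₂ (refl , refl) = trans (sym (mono (∈-edges G e))) (constant vs)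
    single : ∀ cs → Unique cs → (∀ {c} → c ∈ cs → ∃[ v ] f v ≡ c) → length cs ≤ 1
    single []          _ _ = z≤n
    single (_ ∷ [])    _ _ = s≤s z≤n
    single (c ∷ d ∷ _) ((c≢d ∷ _) ∷ _) used with used (here refl) | used (there (here refl))
    ... | v , refl | w , refl = contradiction (constant (conn v w)) c≢d

-- Paths, and separation by an edge of an acyclic graph

data Trail {A : Set} (R : Rel A 0ℓ) (z : A) : A → List A → Set where
  done : Trail R z z []
  _∷_  : ∀ {x y ys} → R x y → Trail R z y ys → Trail R z x (y ∷ ys)

module _ {A : Set} {R : Rel A 0ℓ} where

  close : ∀ {x z w ys} → Trail R z x ys → R z w → Linked R (x ∷ ys ∷ʳ w)
  close done    r = r ∷ [-]
  close (q ∷ t) r = q ∷ close t r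

  suffix : ∀ {x y z ys} → Trail R z y ys → Unique (y ∷ ys) → x ∈ y ∷ ys →
           ∃[ xs ] Trail R z x xs × Unique (x ∷ xs)
  suffix t       u       (here refl) = _ , t , u
  suffix (_ ∷ t) (_ ∷ u) (there p)   = suffix t u p

  -- If `x` recurs on the repetition-free trail from the next vertex, the part before the recurrence
  -- is cut off.
  erase-loops : DecidableEquality A → ∀ {x z} → Star R x z → ∃[ xs ] Trail R z x xs × Unique (x ∷ xs)
  erase-loops _≟_ ε = [] , done , [] ∷ []
  erase-loops _≟_ {x} (r ◅ rs) with erase-loops _≟_ rs
  ... | ys , t , u with x ∈? (_ ∷ ys)
    where open DecMembership _≟_
  ...   | yes x∈ = suffix t u x∈
  ...   | no x∉  = _ , r ∷ t , All.¬Any⇒All¬ _ x∉ ∷ u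

module _ {n : ℕ} {G : Graph n} where

  -- Adjacency in G - e, so that `u ∼[ e ] v` means that `u` and `v` lie in one component of G - e.
  AdjOff : Edge G → Rel (Fin n) 0ℓ
  AdjOff e u v = ∃[ f ] Joins f u v × f ≢ e

  _∼[_]_ : Fin n → Edge G → Fin n → Set
  u ∼[ e ] v = Star (AdjOff e) u v

  ∼-sym : ∀ {e u v} → u ∼[ e ] v → v ∼[ e ] u
  ∼-sym = Star.reverse λ { (f , j , f≢e) → f , joins-sym f j , f≢e }

  step-off : ∀ {e f u v} → Joins f u v → f ≢ e → u ∼[ e ] v
  step-off j f≢e = (_ , j , f≢e) ◅ ε

  module _ (acyclic : ¬ Cycle G) where

    -- A repetition-free path between the ends of `e` that avoids `e` is closed to a cycle by `e`. A
    -- path of length one would be an edge with the same ends, which is `e` itself.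
    lo≁hi : ∀ e → ¬ lo e ∼[ e ] hi e
    lo≁hi e p with erase-loops Fin._≟_ p
    ... | [] , done′ , _ = lo≢hi e (ends done′)
      where
      ends : ∀ {x z} → Trail (AdjOff e) z x [] → x ≡ z
      ends done = refl
    ... | _ ∷ [] , (f , j , f≢e) ∷ done , _ = f≢e (joins-unique f e j (inj₁ (refl , refl)))
    ... | ws@(_ ∷ _ ∷ _) , t , u =
      acyclic (lo e , ws , s≤s (s≤s z≤n) , u ,
        close (map-trail t) (joins⇒adj e (inj₂ (refl , refl))))
      where
      map-trail : ∀ {z x xs} → Trail (AdjOff e) z x xs → Trail (Adj G) z x xs
      map-trail done = done
      map-trail ((f , j , _) ∷ t) = joins⇒adj f j ∷ map-trail t

    joins⇒≁ : ∀ e {u v} → Joins e u v → ¬ u ∼[ e ] v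
    joins⇒≁ e (inj₁ (refl , refl)) = lo≁hi e
    joins⇒≁ e (inj₂ (refl , refl)) = lo≁hi e ∘ ∼-sym

  module _ {L : Labelling G} where

    -- A journey that avoids `e` stays in one component of G - e. The bound `l ≤ m` allows
    -- comparison with labels used before this journey.
    crossing : ∀ {e u v l} → ¬ u ∼[ e ] v → Journey L l u v → ∃[ m ] l ≤ m × Label L e m
    crossing {e} u≁v [ f , j , lab ] with f ≟ᴱ e
    ... | yes refl = _ , ≤-refl , lab
    ... | no f≢e   = contradiction (step-off j f≢e) u≁v
    crossing {e} u≁v ((f , j , lab) ∷⟨ l<m ⟩ js) with f ≟ᴱ e
    ... | yes refl = _ , ≤-refl , lab
    ... | no f≢e with crossing (u≁v ∘ (step-off j f≢e ◅◅_)) js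
    ...   | k , m≤k , lab′ = k , ≤-trans (<⇒≤ l<m) m≤k , lab′

    -- The edge e separates u from both endpoints of f, so the journey has to
    -- take e before it can take f.
    crossing₂ : ∀ {e f c d u v l} → e ≢ f → Joins f c d → ¬ u ∼[ e ] c → ¬ u ∼[ f ] v →
                Journey L l u v → ∃[ l₁ ] ∃[ l₂ ] l₁ < l₂ × Label L e l₁ × Label L f l₂
    crossing₂ {e} {f} {c} {d} {u} e≢f jf u≁c u≁v = go
      where
      -- The journey cannot start with `f`: otherwise `u` would be `c`, or would reach `c` along
      -- `f`, which is different from `e`.
      not-at-f : ∀ {w} → ¬ Joins f u w
      not-at-f j = u≁c (at-f j jf)
        where
        at-f : ∀ {w} → Joins f u w → Joins f c d → u ∼[ e ] c
        at-f (inj₁ (refl , refl)) (inj₁ (refl , refl)) = ε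
        at-f j@(inj₁ (refl , refl)) (inj₂ (refl , refl)) = step-off j (≢-sym e≢f)
        at-f j@(inj₂ (refl , refl)) (inj₁ (refl , refl)) = step-off j (≢-sym e≢f)
        at-f (inj₂ (refl , refl)) (inj₂ (refl , refl)) = ε
      go : ∀ {l} → Journey L l u _ → ∃[ l₁ ] ∃[ l₂ ] l₁ < l₂ × Label L e l₁ × Label L f l₂
      go [ g , j , lab ] with g ≟ᴱ f
      ... | yes refl = contradiction j not-at-f
      ... | no g≢f   = contradiction (step-off j g≢f) u≁v
      go ((g , j , lab) ∷⟨ l<m ⟩ js) with g ≟ᴱ f | g ≟ᴱ e
      ... | yes refl | _ = contradiction j not-at-f
      -- After the step along `e`, the rest of the journey still has to cross `f`, and its labels
      -- are larger.
      ... | no g≢f | yes refl with crossing (u≁v ∘ (step-off j g≢f ◅◅_)) js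
      ...   | k , m≤k , lab′ = _ , k , ≤-trans l<m m≤k , lab , lab′
      go ((g , j , lab) ∷⟨ l<m ⟩ js) | no g≢f | no g≢e =
        crossing₂ e≢f jf (u≁c ∘ (step-off j g≢e ◅◅_)) (u≁v ∘ (step-off j g≢f ◅◅_)) js

-- Counting labels in a temporally connected tree

hasSize-unique : ∀ {P k} → HasSize P k → k < 2 → ∀ {x y} → P x → P y → x ≡ y
hasSize-unique ([] , _ , iff , _) _ px _ = contradiction (Equivalence.from (iff _) px) λ ()
hasSize-unique (z ∷ [] , _ , iff , _) _ px py
  with Equivalence.from (iff _) px | Equivalence.from (iff _) py
... | here refl | here refl = refl
hasSize-unique (_ ∷ _ ∷ _ , _ , _ , refl) (s≤s (s≤s ())) _ _

hasSize-pos : ∀ {P k x} → HasSize P k → P x → 1 ≤ k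
hasSize-pos ([]    , _ , iff , _)    px = contradiction (Equivalence.from (iff _) px) λ ()
hasSize-pos (_ ∷ _ , _ , _   , refl) px = s≤s z≤n

module _ {A : Set} {f : A → ℕ} where

  sum-map-≥2 : ∀ {xs} → All (λ x → 2 ≤ f x) xs → 2 * length xs ≤ sum (map f xs)
  sum-map-≥2 [] = z≤n
  sum-map-≥2 {_ ∷ xs} (p ∷ ps) = ≤-trans (≤-reflexive (*-suc 2 (length xs))) (+-mono-≤ p (sum-map-≥2 ps))

  -- Once a value below 2 occurs, it still contributes 1 and all later values are at least 2, so
  -- only 1 is lost in total.
  sum-map-≥2-but-one : ∀ {xs} → Unique xs → (∀ x → 1 ≤ f x) → (∀ {x y} → x ≢ y → f x < 2 → 2 ≤ f y) →
                       2 * length xs ≤ suc (sum (map f xs))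
  sum-map-≥2-but-one [] _ _ = z≤n
  sum-map-≥2-but-one {x ∷ xs} (x∉ ∷ u) pos two = ≤-trans (≤-reflexive (*-suc 2 (length xs))) bound
    where
    bound : 2 + 2 * length xs ≤ suc (f x + sum (map f xs))
    bound with f x <? 2
    ... | yes fx<2 = s≤s (+-mono-≤ (pos x) (sum-map-≥2 (All.map (λ x≢y → two x≢y fx<2) x∉)))
    ... | no fx≮2  = ≤-trans (+-mono-≤ (≮⇒≥ fx≮2) (sum-map-≥2-but-one u pos two))
                       (≤-reflexive (+-suc (f x) _))

module _ {n : ℕ} {G : Graph n} (acyclic : ¬ Cycle G) {L : Labelling G} (tc : TC L) where

  edge-labelled : ∀ e → ∃[ l ] Label L e l
  edge-labelled e with tc (lo e) (hi e) (lo≢hi e)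
  ... | _ , js with crossing (lo≁hi acyclic e) js
  ...   | l , _ , lab = l , lab

  -- Both `e` and `f` separate `a` from `d`, with `a` an end of `e` and `d` an end of `f`. The
  -- journey from `a` to `d` takes `e` before `f`, the one back takes `f` before `e`, and single
  -- labels cannot satisfy both orders.
  outer-ends : ∀ {e f a b c d} → e ≢ f → Joins e a b → Joins f d c → ¬ a ∼[ e ] d → ¬ d ∼[ f ] a →
               (∀ {x y} → Label L e x → Label L e y → x ≡ y) →
               ¬ (∀ {x y} → Label L f x → Label L f y → x ≡ y)
  outer-ends {a = a} {d = d} e≢f je jf a≁d d≁a e! f!
    with tc a d (λ { refl → a≁d ε }) | tc d a (λ { refl → d≁a ε })
  ... | _ , ad | _ , da
    with crossing₂ e≢f jf a≁d (d≁a ∘ ∼-sym) ad | crossing₂ (≢-sym e≢f) je d≁a (a≁d ∘ ∼-sym) da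
  ... | _ , _ , k<l , ek , fl | _ , _ , l′<k′ , fl′ , ek′ with e! ek ek′ | f! fl fl′
  ...   | refl | refl = <-asym k<l l′<k′

  -- If both ends of `e` were connected to `x` in G - e, they would be connected to each other. The
  -- double negation selects an end without deciding `_∼[ e ]_`, which suffices for deriving a
  -- contradiction.
  some-end-apart : ∀ (e : Edge G) x → (∀ {a b} → Joins e a b → ¬ ¬ a ∼[ e ] x) → ⊥
  some-end-apart e x near =
    near {lo e} (inj₁ (refl , refl)) λ lo∼x → near {hi e} (inj₂ (refl , refl)) λ hi∼x →
      lo≁hi acyclic e (lo∼x ◅◅ ∼-sym hi∼x)

  single-labels-absurd : ∀ {e f} → e ≢ f → (∀ {x y} → Label L e x → Label L e y → x ≡ y) →
                         ¬ (∀ {x y} → Label L f x → Label L f y → x ≡ y)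
  single-labels-absurd {e} {f} e≢f e! f! =
    -- First `a` is chosen as an end of `e` cut off from `lo f` by `e`, then `d` as an end of `f`
    -- cut off from `a` by `f`. Since `f` joins its own ends in G - e, `e` cuts `a` off from `d` as
    -- well.
    some-end-apart e (lo f) λ {a} je a≁lo →
    some-end-apart f a λ {d} jf d≁a →
      outer-ends e≢f je jf (a≁lo ∘ (_◅◅ to-lo jf)) d≁a e! f!
    where
    to-lo : ∀ {d c} → Joins f d c → d ∼[ e ] lo f
    to-lo (inj₁ (refl , refl)) = ε
    to-lo j@(inj₂ (refl , refl)) = step-off j (≢-sym e≢f)

  cost-bound : Connected G → ∀ {c} → HasCost L c → 2 * n ∸ 3 ≤ c
  -- The 3 consists of 2 from `n ≤ suc (length (edges G))` and 1 for the edge that may have a single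
  -- label.
  cost-bound conn {c} (size , hasSize , refl) = m≤n+o⇒m∸n≤o (2 * n) 3 $ begin
    2 * n                            ≤⟨ *-monoʳ-≤ 2 (connected⇒enough-edges conn) ⟩
    2 * suc (length (edges G))       ≡⟨ *-suc 2 _ ⟩
    2 + 2 * length (edges G)         ≤⟨ s≤s (s≤s (sum-map-≥2-but-one (edges-unique G)
                                          (λ e → hasSize-pos (hasSize e) (proj₂ (edge-labelled e))) two)) ⟩
    3 + c                            ∎
    where
    open ≤-Reasoning
    two : ∀ {e f} → e ≢ f → size e < 2 → 2 ≤ size f
    two e≢f e<2 = ≮⇒≥ λ f<2 → single-labels-absurd e≢f
      (hasSize-unique (hasSize _) e<2) (hasSize-unique (hasSize _) f<2)

-- Labelled growth of a spanning tree

sum-map-0 : ∀ {A : Set} (xs : List A) → sum (map (λ _ → 0) xs) ≡ 0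
sum-map-0 []       = refl
sum-map-0 (_ ∷ xs) = sum-map-0 xs

module _ {A B : Set} {R : A → B → Set} (R? : ∀ a b → Dec (R a b))
         (functional : ∀ {a a′ b} → R a b → R a′ b → a ≡ a′) where

  private
    count : List B → A → ℕ
    count bs a = length (filter (R? a) bs)

  sum-count-∷-unrelated : ∀ {b bs as} → All (λ a → ¬ R a b) as →
                          sum (map (count (b ∷ bs)) as) ≡ sum (map (count bs) as)
  sum-count-∷-unrelated [] = refl
  sum-count-∷-unrelated {b} {as = a ∷ _} (¬r ∷ ¬rs) with R? a b
  ... | yes r = contradiction r ¬r
  ... | no _  = cong (_ +_) (sum-count-∷-unrelated ¬rs)

  sum-count-∷ : ∀ {a b bs as} → Unique as → a ∈ as → R a b →
                sum (map (count (b ∷ bs)) as) ≡ suc (sum (map (count bs) as))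
  sum-count-∷ {a} {b} (a∉ ∷ _) (here refl) r with R? a b
  ... | yes _ = cong (suc ∘ (_ +_)) (sum-count-∷-unrelated (All.map (λ a≢ r′ → a≢ (functional r r′)) a∉))
  ... | no ¬r = contradiction r ¬r
  sum-count-∷ {b = b} {as = a′ ∷ _} (a′∉ ∷ u) (there a∈) r with R? a′ b
  ... | yes r′ = contradiction (functional r′ r) (All.lookup a′∉ a∈)
  ... | no _   = trans (cong (_ +_) (sum-count-∷ u a∈ r)) (+-suc _ _)

  -- Double counting: each `b` is related to exactly one entry of `as`. With edges and triples in
  -- these roles, it gives the cost of a labelling.
  sum-count : ∀ {as} → Unique as → ∀ bs → (∀ {b} → b ∈ bs → ∃[ a ] a ∈ as × R a b) →
              sum (map (count bs) as) ≡ length bs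
  sum-count {as} _ [] _ = sum-map-0 as
  sum-count u (b ∷ bs) total with total (here refl)
  ... | a , a∈ , r = trans (sum-count-∷ u a∈ r) (cong suc (sum-count u bs (total ∘ there)))

-- Labellings given by lists of triples

Triple : ℕ → Set
Triple n = Fin n × Fin n × ℕ

label : ∀ {n} → Triple n → ℕ
label (_ , _ , l) = l

module _ {n : ℕ} {G : Graph n} where

  JoinsEnds : Edge G → Triple n → Set
  JoinsEnds e (u , v , _) = Joins e u v

  joinsEnds? : ∀ e t → Dec (JoinsEnds e t)
  joinsEnds? e (u , v , _) =
    (u Fin.≟ lo e ×-dec v Fin.≟ hi e) ⊎-dec (u Fin.≟ hi e ×-dec v Fin.≟ lo e)

  -- As the labels in `ts` are pairwise different, no two triples give the same label to an edge,
  -- and the cost is the length of `ts`.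
  module FromTriples (ts : List (Triple n))
                     (ts-adj : ∀ {u v l} → (u , v , l) ∈ ts → Adj G u v)
                     (ts-pos : ∀ {t} → t ∈ ts → NonZero (label t))
                     (ts-distinct : AllPairs (λ s t → label s ≢ label t) ts) where

    labels : Edge G → List ℕ
    labels e = map label (filter (joinsEnds? e) ts)

    labelling : Labelling G
    labelling .Label e l = l ∈ labels e
    labelling .positive {e} l∈ with ∈-map⁻ label l∈
    ... | _ , t∈ , refl = ts-pos (proj₁ (∈-filter⁻ (joinsEnds? e) {xs = ts} t∈))

    timeEdge : ∀ {u v l} → (u , v , l) ∈ ts → TimeEdge labelling u v l
    timeEdge t∈ with adj⇒joins {G = G} (ts-adj t∈)
    ... | e , j = e , j , ∈-map⁺ label (∈-filter⁺ (joinsEnds? e) t∈ j)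

    cost : HasCost labelling (length ts)
    cost = length ∘ labels
         , (λ e → labels e , AllPairs.map⁺ (AllPairs.filter⁺ (joinsEnds? e) ts-distinct) , (λ _ → mk⇔ id id) , refl)
         , trans (cong sum (map-length (edges G)))
             (sum-count joinsEnds? (λ {e} {f} → joins-unique e f) (edges-unique G) ts
               λ t∈ → let e , j = adj⇒joins {G = G} (ts-adj t∈) in e , ∈-edges G e , j)
      where
      map-length : ∀ es → map (length ∘ labels) es ≡ map (λ e → length (filter (joinsEnds? e) ts)) es
      map-length []       = refl
      map-length (e ∷ es) = cong₂ _∷_ (length-map label (filter (joinsEnds? e) ts)) (map-length es)

    describes : encodeList encodeTriple ts Describes labelling
    describes = ts , refl , (λ _ _ _ → timeEdge) , described
      where
      described : ∀ e l → l ∈ labels e → (lo e , hi e , l) ∈ ts ⊎ (hi e , lo e , l) ∈ ts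
      described e l l∈ with ∈-map⁻ label l∈
      ... | (u , v , .l) , t∈ , refl with ∈-filter⁻ (joinsEnds? e) {xs = ts} t∈
      ...   | t∈ts , inj₁ (refl , refl) = inj₁ t∈ts
      ...   | t∈ts , inj₂ (refl , refl) = inj₂ t∈ts

module _ {n : ℕ} {G : Graph n} {L : Labelling G} where

  last-label : ∀ {l u v} → Journey L l u v → ℕ
  last-label {l} [ _ ]      = l
  last-label (_ ∷⟨ _ ⟩ js) = last-label js

  snoc : ∀ {l m u v w} (js : Journey L l u v) → last-label js < m → TimeEdge L v w m →
         ∃[ ks ] last-label {l} {u} {w} ks ≡ m
  snoc [ e ] l<m e′ = e ∷⟨ l<m ⟩ [ e′ ] , refl
  snoc (e ∷⟨ l<k ⟩ js) k<m e′ with snoc js k<m e′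
  ... | ks , eq = e ∷⟨ l<k ⟩ ks , eq

  -- Labels increase along a journey, so bounding the first and the last one confines all of them to
  -- the window from `a` to `b`.
  JourneyWithin : ℕ → ℕ → Fin n → Fin n → Set
  JourneyWithin a b u v = ∃[ l ] a ≤ l × ∃[ js ] last-label {l} {u} {v} js ≤ b

  widen : ∀ {a a′ b b′ u v} → a′ ≤ a → b ≤ b′ → JourneyWithin a b u v → JourneyWithin a′ b′ u v
  widen a′≤a b≤b′ (l , a≤l , js , ≤b) = l , ≤-trans a′≤a a≤l , js , ≤-trans ≤b b≤b′

timeEdge-sym : ∀ {n} {G : Graph n} (L : Labelling G) {u v l} → TimeEdge L u v l → TimeEdge L v u l
timeEdge-sym _ (e , j , lab) = e , joins-sym e j , lab

-- Search trees, their labels and the search invariant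

module Growth {m : ℕ} (G : Graph (suc m)) (root : Fin (suc m)) where

  -- The tree edges, latest first, each as a pair of parent and new vertex.
  History : Set
  History = List (Fin (suc m) × Fin (suc m))

  visited : History → List (Fin (suc m))
  visited h = root ∷ map proj₂ h

  data Grown : History → Set where
    []   : Grown []
    grow : ∀ {u v h} → u ∈ visited h → Adj G u v → Grown h → Grown ((u , v) ∷ h)

  -- The i-th edge gets the labels m + 1 − i and m + 1 + i, so that it can be
  -- used before and after all journeys along the earlier edges.
  triples : History → List (Triple (suc m))
  triples [] = []
  triples ((u , v) ∷ h) =
    (u , v , suc m ∸ suc (length h)) ∷ (u , v , suc (length h) + suc m) ∷ triples h

  length-triples : ∀ h → length (triples h) ≡ 2 * length h
  length-triples []      = refl
  length-triples (_ ∷ h) = trans (cong (suc ∘ suc) (length-triples h)) (sym (*-suc 2 (length h)))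

  triples-adj : ∀ {h} → Grown h → ∀ {u v l} → (u , v , l) ∈ triples h → Adj G u v
  triples-adj (grow _ uv _) (here refl)         = uv
  triples-adj (grow _ uv _) (there (here refl)) = uv
  triples-adj (grow _ _ g)  (there (there t∈))  = triples-adj g t∈

  -- With `upper`, this places the labels in a window around `suc m`. The two labels of the next
  -- edge fall outside it, one on each side, so labels do not repeat.
  lower : ∀ h {t} → t ∈ triples h → suc m ∸ length h ≤ label t
  lower (_ ∷ h) (here refl)         = ≤-refl
  lower (_ ∷ h) (there (here refl)) = ≤-trans (m∸n≤m (suc m) (suc (length h))) (m≤n+m (suc m) (suc (length h)))
  lower (_ ∷ h) (there (there t∈))  = ≤-trans (∸-monoʳ-≤ (suc m) (n≤1+n (length h))) (lower h t∈)

  upper : ∀ h {t} → t ∈ triples h → label t ≤ length h + suc m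
  upper (_ ∷ h) (here refl)         = ≤-trans (m∸n≤m (suc m) (suc (length h))) (m≤n+m (suc m) (suc (length h)))
  upper (_ ∷ h) (there (here refl)) = ≤-refl
  upper (_ ∷ h) (there (there t∈))  = ≤-trans (upper h t∈) (n≤1+n _)

  -- Centring the labels at `suc m` leaves room for `m` edges before the smaller labels would reach
  -- zero.
  triples-pos : ∀ {h} → length h ≤ m → ∀ {t} → t ∈ triples h → NonZero (label t)
  triples-pos {h} h≤m t∈ = >-nonZero (≤-trans (m<n⇒0<n∸m (s≤s h≤m)) (lower h t∈))

  triples-distinct : ∀ h → length h ≤ suc m → AllPairs (λ s t → label s ≢ label t) (triples h)
  triples-distinct [] _ = []
  triples-distinct (_ ∷ h) h<n =
    (<⇒≢ (<-≤-trans lo<lo (≤-trans (m∸n≤m (suc m) (length h)) (m≤n+m (suc m) (suc (length h)))))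
      ∷ All.tabulate (λ t∈ → <⇒≢ (<-≤-trans lo<lo (lower h t∈))))
    ∷ All.tabulate (λ t∈ → ≢-sym (<⇒≢ (s≤s (upper h t∈))))
    ∷ triples-distinct h (<⇒≤ h<n)
    where
    lo<lo : suc m ∸ suc (length h) < suc m ∸ length h
    lo<lo = ∸-monoʳ-< ≤-refl h<n

  module _ {L : Labelling G} where

    -- Journeys between old vertices stay inside the old window, so a step with the new smaller
    -- label can precede them and one with the new larger label can follow them.
    grown-connected : ∀ {h} → Grown h → length h ≤ suc m →
      (∀ {u v l} → (u , v , l) ∈ triples h → TimeEdge L u v l) →
      ∀ {x y} → x ∈ visited h → y ∈ visited h → x ≢ y →
      JourneyWithin {L = L} (suc m ∸ length h) (length h + suc m) x y
    grown-connected [] _ _ (here refl) (here refl) x≢y = contradiction refl x≢y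
    grown-connected (grow {u} {v} {h} u∈ _ g) h<n te {x} {y} x∈ y∈ x≢y = from (split x∈) (split y∈)
      where
      a b a′ b′ : ℕ
      a  = suc m ∸ length h
      b  = length h + suc m
      a′ = suc m ∸ suc (length h)
      b′ = suc b
      a′<a : a′ < a
      a′<a = ∸-monoʳ-< ≤-refl h<n
      a′≤b′ : a′ ≤ b′
      a′≤b′ = ≤-trans (<⇒≤ a′<a) (≤-trans (m∸n≤m (suc m) (length h)) (m≤n+m (suc m) (suc (length h))))
      split : ∀ {w} → w ∈ root ∷ v ∷ map proj₂ h → w ≡ v ⊎ w ∈ visited h
      split (here refl)         = inj₂ (here refl)
      split (there (here refl)) = inj₁ refl
      split (there (there x∈))  = inj₂ (there x∈)
      old : ∀ {w z} → w ∈ visited h → z ∈ visited h → w ≢ z → JourneyWithin a b w z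
      old = grown-connected g (<⇒≤ h<n) (te ∘ there ∘ there)
      from : x ≡ v ⊎ x ∈ visited h → y ≡ v ⊎ y ∈ visited h → JourneyWithin a′ b′ x y
      from (inj₁ refl) (inj₁ refl) = contradiction refl x≢y
      from (inj₂ x∈)   (inj₂ y∈)   = widen (<⇒≤ a′<a) (n≤1+n b) (old x∈ y∈ x≢y)
      from (inj₁ refl) (inj₂ y∈) with u Fin.≟ y
      ... | yes refl = a′ , ≤-refl , [ timeEdge-sym L (te (here refl)) ] , a′≤b′
      ... | no u≢y with old u∈ y∈ u≢y
      ...   | l , a≤l , js , ≤b =
        a′ , ≤-refl , timeEdge-sym L (te (here refl)) ∷⟨ <-≤-trans a′<a a≤l ⟩ js , ≤-trans ≤b (n≤1+n b)
      from (inj₂ x∈) (inj₁ refl) with x Fin.≟ u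
      ... | yes refl = b′ , a′≤b′ , [ te (there (here refl)) ] , ≤-refl
      ... | no x≢u with old x∈ u∈ x≢u
      ...   | l , a≤l , js , ≤b with snoc js (s≤s ≤b) (te (there (here refl)))
      ...     | ks , eq = l , ≤-trans (<⇒≤ a′<a) a≤l , ks , ≤-reflexive eq

  -- `Q` holds the visited vertices whose scan is not complete, `U` the unvisited ones. By
  -- `frontier`, a completely scanned vertex has no neighbour in `U`.
  record Invariant (Q U : List (Fin (suc m))) (h : History) : Set where
    field
      grown    : Grown h
      queued   : ∀ {v} → v ∈ Q → v ∈ visited h
      counted  : length h + length U ≡ m
      covered  : ∀ v → v ∈ visited h ⊎ v ∈ U
      frontier : ∀ {u v} → v ∈ U → Adj G u v → u ∈ U ⊎ u ∈ Q
      root∉    : root ∉ U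

  open Invariant

  invariant-resp-↭ : ∀ {Q U W h} → U ↭ W → Invariant Q U h → Invariant Q W h
  invariant-resp-↭ p i = record
    { grown    = grown i
    ; queued   = queued i
    ; counted  = trans (cong (_ +_) (sym (↭-length p))) (counted i)
    ; covered  = λ v → Sum.map₂ (∈-resp-↭ p) (covered i v)
    ; frontier = λ v∈ uv → Sum.map₁ (∈-resp-↭ p) (frontier i (∈-resp-↭ (↭-sym p) v∈) uv)
    ; root∉    = root∉ i ∘ ∈-resp-↭ (↭-sym p)
    }

  -- During its scan `u` still counts as queued, because other neighbours of it may be in `U`;
  -- `dequeue` releases it when none is left.
  discover : ∀ {u v Q U h} → Adj G u v → Invariant (u ∷ Q) (v ∷ U) h →
             Invariant (u ∷ v ∷ Q) U ((u , v) ∷ h)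
  discover {u} {v} {Q} {U} {h} uv i = record
    { grown    = grow (queued i (here refl)) uv (grown i)
    ; queued   = queued′
    ; counted  = trans (sym (+-suc (length h) (length U))) (counted i)
    ; covered  = λ w → covered′ (covered i w)
    ; frontier = λ v∈ wv → frontier′ (frontier i (there v∈) wv)
    ; root∉    = root∉ i ∘ there
    }
    where
    later : ∀ {w} → w ∈ visited h → w ∈ visited ((u , v) ∷ h)
    later (here refl) = here refl
    later (there w∈)  = there (there w∈)
    queued′ : ∀ {w} → w ∈ u ∷ v ∷ Q → w ∈ visited ((u , v) ∷ h)
    queued′ (here refl)         = later (queued i (here refl))
    queued′ (there (here refl)) = there (here refl)
    queued′ (there (there w∈))  = later (queued i (there w∈))
    covered′ : ∀ {w} → w ∈ visited h ⊎ w ∈ v ∷ U → w ∈ visited ((u , v) ∷ h) ⊎ w ∈ U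
    covered′ (inj₁ w∈)          = inj₁ (later w∈)
    covered′ (inj₂ (here refl)) = inj₁ (there (here refl))
    covered′ (inj₂ (there w∈))  = inj₂ w∈
    frontier′ : ∀ {w} → w ∈ v ∷ U ⊎ w ∈ u ∷ Q → w ∈ U ⊎ w ∈ u ∷ v ∷ Q
    frontier′ (inj₁ (here refl)) = inj₂ (there (here refl))
    frontier′ (inj₁ (there w∈))  = inj₁ w∈
    frontier′ (inj₂ (here refl)) = inj₂ (here refl)
    frontier′ (inj₂ (there w∈))  = inj₂ (there (there w∈))

  dequeue : ∀ {u Q U h} → All (λ v → ¬ Adj G u v) U → Invariant (u ∷ Q) U h → Invariant Q U h
  dequeue {u} {Q} {U} none i = record
    { grown    = grown i
    ; queued   = queued i ∘ there
    ; counted  = counted i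
    ; covered  = covered i
    ; frontier = frontier′
    ; root∉    = root∉ i
    }
    where
    frontier′ : ∀ {w v} → v ∈ U → Adj G w v → w ∈ U ⊎ w ∈ Q
    frontier′ v∈ wv with frontier i v∈ wv
    ... | inj₁ w∈           = inj₁ w∈
    ... | inj₂ (there w∈)   = inj₂ w∈
    ... | inj₂ (here refl)  = contradiction wv (All.lookup none v∈)

  -- With an empty queue, U is closed under adjacency and misses the root.
  exhausted : Connected G → ∀ {U h} → Invariant [] U h → U ≡ []
  exhausted conn {[]}    _ = refl
  exhausted conn {v ∷ U} i = contradiction (closed (conn root v)) (root∉ i)
    where
    closed : ∀ {w} → Star (Adj G) w v → w ∈ v ∷ U
    closed ε         = here refl
    closed (wx ◅ xs) with frontier i (closed xs) wx
    ... | inj₁ w∈ = w∈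

  module Result (conn : Connected G) {U h} (i : Invariant [] U h) where

    private
      U≡[] : U ≡ []
      U≡[] = exhausted conn i

    length-history : length h ≡ m
    length-history = trans (sym (+-identityʳ _))
      (trans (cong (λ W → length h + length W) (sym U≡[])) (counted i))

    all-visited : ∀ v → v ∈ visited h
    all-visited v with covered i v | U≡[]
    ... | inj₁ v∈ | _ = v∈
    ... | inj₂ () | refl

    open FromTriples {G = G} (triples h) (triples-adj (grown i)) (triples-pos (≤-reflexive length-history))
      (triples-distinct h (≤-trans (≤-reflexive length-history) (n≤1+n m))) public

    cost-2m : HasCost labelling (2 * m)
    cost-2m = subst (HasCost labelling) (trans (length-triples h) (cong (2 *_) length-history)) cost

    temporally-connected : TC labelling
    temporally-connected u v u≢v
      with grown-connected (grown i) (≤-trans (≤-reflexive length-history) (n≤1+n m)) timeEdge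
             (all-visited u) (all-visited v) u≢v
    ... | l , _ , js , _ = l , js

-- The program

module _ {k : ℕ} where

  -- Only an upper bound on the time is recorded, so that branches and rounds of different cost can
  -- share one bound.
  Runs : Cmd k → Store k → Store k → ℕ → Set
  Runs C σ τ b = ∃[ t ] (⟨ C , σ ⟩⇓ τ in-time t) × t ≤ b

  runs-within : ∀ {C σ τ b b′} → b ≤ b′ → Runs C σ τ b → Runs C σ τ b′
  runs-within b≤b′ (t , C⇓ , t≤b) = t , C⇓ , ≤-trans t≤b b≤b′

  runs-≔ : ∀ {x E σ} → Runs (x ≔ E) σ (σ [ x ]≔ ⟦ E ⟧ σ) (1 + timeᴱ E)
  runs-≔ = _ , assign , ≤-refl

  infixr 4 _then_
  _then_ : ∀ {C D σ ρ τ b c} → Runs C σ ρ b → Runs D ρ τ c → Runs (C ⨟ D) σ τ (b + c)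
  (_ , C⇓ , p) then (_ , D⇓ , q) = _ , seq C⇓ D⇓ , +-mono-≤ p q

  runs-≔-as : ∀ {x E σ d} → ⟦ E ⟧ σ ≡ d → Runs (x ≔ E) σ (σ [ x ]≔ d) (1 + timeᴱ E)
  runs-≔-as refl = runs-≔

  runs-then : ∀ {E C D σ τ b} → ⟦ E ⟧ σ ≢ nil → Runs C σ τ b →
              Runs (if E then C else D) σ τ (1 + timeᴱ E + b)
  runs-then E≢nil (_ , C⇓ , p) = _ , if-true E≢nil C⇓ , +-monoʳ-≤ _ p

  runs-else : ∀ {E C D σ τ b} → ⟦ E ⟧ σ ≡ nil → Runs D σ τ b →
              Runs (if E then C else D) σ τ (1 + timeᴱ E + b)
  runs-else eq (_ , D⇓ , p) = _ , if-false eq D⇓ , +-monoʳ-≤ _ p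

  runs-while : ∀ {E C σ ρ τ b c} → ⟦ E ⟧ σ ≢ nil → Runs C σ ρ b → Runs (while E loop C) ρ τ c →
               Runs (while E loop C) σ τ (1 + timeᴱ E + b + c)
  runs-while E≢nil (_ , C⇓ , p) (_ , W⇓ , q) =
    _ , while-true E≢nil C⇓ W⇓ , +-mono-≤ (+-monoʳ-≤ _ p) q

  runs-end : ∀ {E C σ} → ⟦ E ⟧ σ ≡ nil → Runs (while E loop C) σ σ (1 + timeᴱ E)
  runs-end eq = _ , while-false eq , ≤-refl

-- `low` and `high` hold the latest pair of labels, `row` the matrix row of `source`, and `kept` the
-- tested vertices not adjacent to `source`. `cell` and `index` serve for traversing lists.
graph queue unseen out low high source kept row cell index : Fin 11
graph  = # 0
queue  = # 1
unseen = # 2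
out    = # 3
low    = # 4
high   = # 5
source = # 6
kept   = # 7
row    = # 8
cell   = # 9
index  = # 10

-- One numeral is pushed per matrix row, so `unseen` becomes n - 1, ..., 0 and `low` becomes n.
number : Cmd 11
number = while (var cell) loop
  ( unseen ≔ `cons (var low) (var unseen)
  ⨟ low ≔ `cons `nil (var low)
  ⨟ cell ≔ `tl (var cell) )

-- List lookup: the entry at the position initially in `index` ends up at the head of `cell`.
descend : Cmd 11
descend = while (var index) loop
  ( cell ≔ `tl (var cell)
  ⨟ index ≔ `tl (var index) )

-- New vertices go to the front, so `queue` acts as a stack. The labels are moved apart before they
-- are output, hence the first edge gets n - 1 and n + 1.
found : Cmd 11
found =
    queue ≔ `cons (`hd (var unseen)) (var queue)
  ⨟ low ≔ `tl (var low)
  ⨟ high ≔ `cons `nil (var high)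
  ⨟ out ≔ `cons (triple low) (`cons (triple high) (var out))
  where
  triple : Fin 11 → Expr 11
  triple l = `cons (var source) (`cons (`hd (var unseen)) (var l))

scan : Cmd 11
scan = while (var unseen) loop
  ( cell ≔ var row
  ⨟ index ≔ `hd (var unseen)
  ⨟ descend
  ⨟ if (`hd (var cell))
      then found
      else (kept ≔ `cons (`hd (var unseen)) (var kept))
  ⨟ unseen ≔ `tl (var unseen)
  ⨟ cell ≔ `nil )

search : Cmd 11
search = while (var queue) loop
  ( source ≔ `hd (var queue)
  ⨟ queue ≔ `tl (var queue)
  ⨟ cell ≔ var graph
  ⨟ index ≔ var source
  ⨟ descend
  ⨟ row ≔ `hd (var cell)
  ⨟ cell ≔ `nil
  ⨟ kept ≔ `nil
  ⨟ scan
  ⨟ unseen ≔ var kept )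

program : Program
program .extraVars = 10
program .body =
    cell ≔ var graph
  ⨟ number
  ⨟ high ≔ var low
  -- The head of `unseen`, vertex n - 1, becomes the root.
  ⨟ queue ≔ `cons (`hd (var unseen)) `nil
  ⨟ unseen ≔ `tl (var unseen)
  ⨟ search
  ⨟ graph ≔ var out

-- Auxiliary loops and the time bound

tails : ℕ → 𝔻 → 𝔻
tails zero    d = d
tails (suc k) d = tails k (tail d)

head-tails-tabulate : ∀ {A : Set} (f : A → 𝔻) {n} (g : Fin n → A) i →
                      head (tails (toℕ i) (encodeList f (tabulate g))) ≡ f (g i)
head-tails-tabulate f g Fin.zero    = refl
head-tails-tabulate f g (Fin.suc i) = head-tails-tabulate f (g ∘ Fin.suc) i

tail-encodeℕ : ∀ k → tail (encodeℕ k) ≡ encodeℕ (pred k)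
tail-encodeℕ zero    = refl
tail-encodeℕ (suc k) = refl

length≤∥encodeList∥ : ∀ {A : Set} (f : A → 𝔻) xs → length xs ≤ ∥ encodeList f xs ∥
length≤∥encodeList∥ f []       = z≤n
length≤∥encodeList∥ f (x ∷ xs) = s≤s (≤-trans (length≤∥encodeList∥ f xs) (m≤n+m _ ∥ f x ∥))

module _ {M Q U O lo hi u R r : 𝔻} where

  runs-descend : ∀ k d →
    Runs descend (M ∷ Q ∷ U ∷ O ∷ lo ∷ hi ∷ u ∷ R ∷ r ∷ d ∷ encodeℕ k ∷ [])
                 (M ∷ Q ∷ U ∷ O ∷ lo ∷ hi ∷ u ∷ R ∷ r ∷ tails k d ∷ nil ∷ []) (k * 8 + 2)
  runs-descend zero    d = runs-end refl
  runs-descend (suc k) d = runs-while (λ ()) (runs-≔ then runs-≔) (runs-descend k (tail d))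

  runs-descend-Fin : ∀ {n} (v : Fin n) d →
    Runs descend (M ∷ Q ∷ U ∷ O ∷ lo ∷ hi ∷ u ∷ R ∷ r ∷ d ∷ encodeℕ (toℕ v) ∷ [])
                 (M ∷ Q ∷ U ∷ O ∷ lo ∷ hi ∷ u ∷ R ∷ r ∷ tails (toℕ v) d ∷ nil ∷ []) (n * 8 + 2)
  runs-descend-Fin v d = runs-within (+-monoˡ-≤ 2 (*-monoˡ-≤ 8 (Fin.toℕ≤n v))) (runs-descend (toℕ v) d)

encodeFins : ∀ {n} → List (Fin n) → 𝔻
encodeFins = encodeList (encodeℕ ∘ toℕ)

module _ {n : ℕ} where

  downFrom : ∀ k → .(k ≤ n) → List (Fin n)
  downFrom zero    _   = []
  downFrom (suc k) k<n = fromℕ< k<n ∷ downFrom k (<⇒≤ k<n)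

  length-downFrom : ∀ k .(k≤n : k ≤ n) → length (downFrom k k≤n) ≡ k
  length-downFrom zero    _   = refl
  length-downFrom (suc k) k<n = cong suc (length-downFrom k (<⇒≤ k<n))

  ∈-downFrom⁺ : ∀ {v} k .(k≤n : k ≤ n) → toℕ v < k → v ∈ downFrom k k≤n
  ∈-downFrom⁺ {v} (suc k) k<n (s≤s v≤k) with m≤n⇒m<n∨m≡n v≤k
  ... | inj₁ v<k  = there (∈-downFrom⁺ k (<⇒≤ k<n) v<k)
  ... | inj₂ refl = here (Fin.toℕ-injective (sym (Fin.toℕ-fromℕ< k<n)))

  ∈-downFrom⁻ : ∀ {v} k .(k≤n : k ≤ n) → v ∈ downFrom k k≤n → toℕ v < k
  ∈-downFrom⁻ (suc k) k<n (here refl) = s≤s (≤-reflexive (Fin.toℕ-fromℕ< k<n))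
  ∈-downFrom⁻ (suc k) k<n (there v∈)  = <-trans (∈-downFrom⁻ k (<⇒≤ k<n) v∈) (n<1+n k)

  runs-number : ∀ {M Q O hi u R r i} {A : Set} (f : A → 𝔻) xs k .(k≤n : k ≤ n) → length xs + k ≡ n →
    Runs number
      (M ∷ Q ∷ encodeFins (downFrom k k≤n) ∷ O ∷ encodeℕ k ∷ hi ∷ u ∷ R ∷ r ∷ encodeList f xs ∷ i ∷ [])
      (M ∷ Q ∷ encodeFins (downFrom n ≤-refl) ∷ O ∷ encodeℕ n ∷ hi ∷ u ∷ R ∷ r ∷ nil ∷ i ∷ [])
      (length xs * 13 + 2)
  runs-number f []       k k≤n refl = runs-end refl
  runs-number f (x ∷ xs) k k≤n eq
    with runs-number f xs (suc k) (≤-trans (s≤s (m≤n+m k (length xs))) (≤-reflexive eq))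
           (trans (+-suc (length xs) k) eq)
  -- The numeral pushed by the program is thereby identified with the code of the new head of
  -- `downFrom`.
  ... | rest rewrite Fin.toℕ-fromℕ< (≤-trans (s≤s (m≤n+m k (length xs))) (≤-reflexive eq)) =
    runs-while (λ ()) (runs-≔ then runs-≔ then runs-≔) rest

-- Bounds for one round of `scan`, one round of `search` and the whole program. The constants add up
-- the commands between inner loops, nested as `_then_` composes them.
scanTime searchTime programTime : ℕ → ℕ
scanTime n    = 7 + ((n * 8 + 2) + 36)
searchTime n  = 12 + ((n * 8 + 2) + (7 + ((n * scanTime n + 2) + 2)))
programTime n = 2 + ((n * 13 + 2) + (10 + ((n * searchTime n + 2) + 2)))

module _ (n : ℕ) .{{_ : NonZero n}} where

  -- A record, so that a and d can be inferred by unification.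
  record _≤[_]n^_ (x a d : ℕ) : Set where
    constructor bound
    field unbound : x ≤ a * n ^ d

  open _≤[_]n^_ public

  private
    infixr 5 _⊕_
    _⊕_ : ∀ {a b x y d} → x ≤[ a ]n^ d → y ≤[ b ]n^ d → (x + y) ≤[ a + b ]n^ d
    _⊕_ {a} {b} {d = d} (bound p) (bound q) =
      bound (≤-trans (+-mono-≤ p q) (≤-reflexive (sym (*-distribʳ-+ (n ^ d) a b))))

    const : ∀ a {d} → a ≤[ a ]n^ d
    const a {d} = bound (m≤m*n a (n ^ d) {{m^n≢0 n d}})

    scale : ∀ {a x d} → x ≤[ a ]n^ d → (n * x) ≤[ a ]n^ suc d
    scale {a} {x} {d} (bound p) = bound $ begin
      n * x            ≤⟨ *-monoʳ-≤ n p ⟩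
      n * (a * n ^ d)  ≡⟨ *-assoc n a (n ^ d) ⟨
      n * a * n ^ d    ≡⟨ cong (_* n ^ d) (*-comm n a) ⟩
      a * n * n ^ d    ≡⟨ *-assoc a n (n ^ d) ⟩
      a * n ^ suc d    ∎
      where open ≤-Reasoning

  -- For positive n, lower powers are absorbed into the highest one, so the coefficient is
  -- `scanTime 1`. Likewise 86 is `searchTime 1` and 117 is `programTime 1`.
  scanTime-linear : scanTime n ≤[ 53 ]n^ 1
  scanTime-linear = const 7 ⊕ (scale (const 8) ⊕ const 2) ⊕ const 36

  searchTime-quadratic : searchTime n ≤[ 86 ]n^ 2
  searchTime-quadratic =
    const 12 ⊕ (scale (const 8) ⊕ const 2) ⊕ const 7 ⊕ (scale scanTime-linear ⊕ const 2) ⊕ const 2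

  programTime-cubic : programTime n ≤[ 117 ]n^ 3
  programTime-cubic =
    const 2 ⊕ (scale (const 13) ⊕ const 2) ⊕ const 10 ⊕ (scale searchTime-quadratic ⊕ const 2) ⊕ const 2

-- Correctness of the search program

module Search {m : ℕ} (G : Graph (suc m)) (root : Fin (suc m)) where

  open Growth G root

  matrix : 𝔻
  matrix = encodeGraph G

  rowOf : Fin (suc m) → 𝔻
  rowOf u = encodeList encodeBool (tabulate (adjacent G u))

  encodeTriples : History → 𝔻
  encodeTriples h = encodeList encodeTriple (triples h)

  store : (Q U : List (Fin (suc m))) (h : History) (u R r c i : 𝔻) → Store 11
  store Q U h u R r c i =
    matrix ∷ encodeFins Q ∷ encodeFins U ∷ encodeTriples h ∷
    encodeℕ (suc m ∸ length h) ∷ encodeℕ (length h + suc m) ∷ u ∷ R ∷ r ∷ c ∷ i ∷ []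

  -- while found runs, v is still at the head of unseen
  runs-found : ∀ {Q u v U h R r c i} →
    Runs found (store Q (v ∷ U) h (encodeℕ (toℕ u)) R r c i)
               (store (v ∷ Q) (v ∷ U) ((u , v) ∷ h) (encodeℕ (toℕ u)) R r c i) 28
  runs-found {h = h} with runs-≔ then runs-≔ then runs-≔ then runs-≔
  ... | run rewrite sym (trans (tail-encodeℕ (suc m ∸ length h))
                          (cong encodeℕ (pred[m∸n]≡m∸[1+n] (suc m) (length h)))) = run

  -- `R` and `R′` are the kept vertices before and after the scan. Each vertex of `U` goes either to
  -- the queue or to the kept ones, which gives `balanced`, needed for the termination measure of
  -- the outer loop.
  record Scanned (u : Fin (suc m)) (Q U R : List (Fin (suc m))) (σ : Store 11) (b : ℕ) : Set where
    field
      {Q′ R′}   : List (Fin (suc m))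
      {h′}      : History
      invariant : Invariant (u ∷ Q′) R′ h′
      scanned   : All (λ v → ¬ Adj G u v) R′
      balanced  : length Q′ + length R′ ≡ length Q + (length U + length R)
      run       : Runs scan σ (store Q′ [] h′ (encodeℕ (toℕ u)) (encodeFins R′) (rowOf u) nil nil) b

  -- The unvisited vertices are split into `U`, still to be tested, and `R`, found not adjacent to
  -- `u`. A vertex that is kept passes from one to the other by a permutation, which the invariant
  -- respects.
  runs-scan : ∀ {u Q R h} U → Invariant (u ∷ Q) (U ++ R) h → All (λ v → ¬ Adj G u v) R →
    Scanned u Q U R (store Q U h (encodeℕ (toℕ u)) (encodeFins R) (rowOf u) nil nil) (length U * scanTime (suc m) + 2)
  runs-scan [] i none = record
    { invariant = i ; scanned = none ; balanced = refl ; run = runs-end refl }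
  runs-scan {u} {Q} {R} {h} (v ∷ U) i none with adjacent G u v in eq
  ... | true  = record
    { Scanned rest
    ; balanced = trans (Scanned.balanced rest) (sym (+-suc (length Q) (length U + length R)))
    ; run = runs-within (≤-reflexive (sym (+-assoc (scanTime (suc m)) (length U * scanTime (suc m)) 2)))
        (runs-while (λ ())
          (runs-≔ then runs-≔ then runs-descend-Fin v (rowOf u) then
            runs-then cell≢nil (runs-found {Q} {u} {v} {U} {h}) then runs-≔ then runs-≔)
          (Scanned.run rest))
    }
    where
    rest = runs-scan U (discover (subst T (sym eq) _) i) none
    cell≢nil : head (tails (toℕ v) (rowOf u)) ≢ nil
    cell≢nil p with trans (sym p) (trans (head-tails-tabulate encodeBool (adjacent G u) v) (cong encodeBool eq))
    ... | ()
  ... | false = record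
    { Scanned rest
    ; balanced = trans (Scanned.balanced rest) (cong (length Q +_) (+-suc (length U) (length R)))
    ; run = runs-within (≤-reflexive (sym (+-assoc (scanTime (suc m)) (length U * scanTime (suc m)) 2)))
        (runs-while (λ ())
          (runs-≔ then runs-≔ then runs-descend-Fin v (rowOf u) then
            -- The 5 steps of this branch are padded to the 28 of `found`.
            runs-else cell≡nil (runs-within (m≤m+n 5 23) runs-≔) then runs-≔ then runs-≔)
          (Scanned.run rest))
    }
    where
    rest = runs-scan U (invariant-resp-↭ (↭-sym (shift v U R)) i) ((λ uv → subst T eq uv) ∷ none)
    cell≡nil : head (tails (toℕ v) (rowOf u)) ≡ nil
    cell≡nil = trans (head-tails-tabulate encodeBool (adjacent G u) v) (cong encodeBool eq)

  record Searched (σ : Store 11) (b : ℕ) : Set where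
    field
      {U}         : List (Fin (suc m))
      {h}         : History
      {u R r c i} : 𝔻
      invariant   : Invariant [] U h
      run         : Runs search σ (store [] U h u R r c i) b

  -- Each round takes one vertex off the queue and otherwise only moves vertices from `U` to the
  -- queue, so the measure `length Q + length U` drops by one.
  runs-search : ∀ k {Q U h u R r c} → length Q + length U ≡ k → Invariant Q U h →
    Searched (store Q U h u R r c nil) (k * searchTime (suc m) + 2)
  runs-search k {[]} _ i = record
    { invariant = i ; run = runs-within (m≤n+m 2 (k * searchTime (suc m))) (runs-end refl)
    }
  runs-search (suc k) {u ∷ Q} {U} {h} eq i = record
    { invariant = Searched.invariant rest
    ; run = runs-within (≤-reflexive (sym (+-assoc (searchTime (suc m)) (k * searchTime (suc m)) 2)))
        (runs-while (λ ())
          (runs-≔ then runs-≔ then runs-≔ then runs-≔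
            then runs-descend-Fin u matrix
            then runs-≔-as (head-tails-tabulate (encodeList encodeBool) (λ u → tabulate (adjacent G u)) u)
            then runs-≔ then runs-≔
            then runs-within (+-monoˡ-≤ 2 (*-monoˡ-≤ (scanTime (suc m)) U≤n)) (Scanned.run inner)
            then runs-≔)
          (Searched.run rest))
    }
    where
    open Invariant
    U≤n : length U ≤ suc m
    U≤n = ≤-trans (m≤n+m (length U) (length h)) (≤-trans (≤-reflexive (counted i)) (n≤1+n m))
    inner = runs-scan {u} {Q} {[]} {h} U (subst (λ W → Invariant (u ∷ Q) W h) (sym (++-identityʳ U)) i) []
    rest = runs-search k
      (trans (Scanned.balanced inner) (trans (cong (length Q +_) (+-identityʳ (length U))) (suc-injective eq)))
      (dequeue (Scanned.scanned inner) (Scanned.invariant inner))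

module _ {m : ℕ} (G : Graph (suc m)) where

  root : Fin (suc m)
  root = fromℕ< (n<1+n m)

  open Growth G root
  open Search G root

  initial : Invariant (root ∷ []) (downFrom m (n≤1+n m)) []
  initial = record
    { grown    = []
    ; queued   = λ v∈ → v∈
    ; counted  = length-downFrom m (n≤1+n m)
    ; covered  = covered
    -- At the start the visited vertices and the queue both consist of the root, so `covered`
    -- already places every vertex.
    ; frontier = λ {u} _ _ → Sum.swap (covered u)
    ; root∉    = λ r∈ → <-irrefl (Fin.toℕ-fromℕ< (n<1+n m)) (∈-downFrom⁻ m (n≤1+n m) r∈)
    }
    where
    covered : ∀ v → v ∈ root ∷ [] ⊎ v ∈ downFrom m (n≤1+n m)
    covered v with ∈-downFrom⁺ {v = v} (suc m) ≤-refl (Fin.toℕ<n v)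
    ... | here v≡root = inj₁ (here v≡root)
    ... | there v∈    = inj₂ v∈

  searched : Searched _ _
  searched = runs-search (suc m) {u = nil} {R = nil} {r = nil} {c = nil}
               (cong suc (length-downFrom m (n≤1+n m))) initial

  rows : Fin (suc m) → List Bool
  rows u = tabulate (adjacent G u)

  runs-program : Runs (body program) (matrix ∷ replicate 10 nil) _ (programTime (suc m))
  runs-program =
    runs-≔
    then runs-within (≤-reflexive (cong (λ k → k * 13 + 2) (length-tabulate rows)))
           (runs-number (encodeList encodeBool) (tabulate rows) 0 z≤n
             (trans (+-identityʳ _) (length-tabulate rows)))
    then runs-≔ then runs-≔ then runs-≔ then Searched.run searched then runs-≔

  -- The encoded matrix is a list with one row per vertex, so its size is at least n.
  programTime≤ : programTime (suc m) ≤ 117 * ∥ matrix ∥ ^ 3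
  programTime≤ = ≤-trans (unbound (programTime-cubic (suc m))) (*-monoʳ-≤ 117 (^-monoˡ-≤ 3 n≤∥matrix∥))
    where
    n≤∥matrix∥ : suc m ≤ ∥ matrix ∥
    n≤∥matrix∥ = subst (_≤ ∥ matrix ∥) (length-tabulate rows)
                   (length≤∥encodeList∥ (encodeList encodeBool) (tabulate rows))

  computes : Connected G →
    ∃[ L ] HasCost {G = G} L (2 * m) × TC L
         × (∃[ r ] (Computes program from matrix to r within (117 * ∥ matrix ∥ ^ 3)) × (r Describes L))
  computes conn =
    labelling , cost-2m , temporally-connected , encodeTriples _ , computation runs-program , describes
    where
    open Result conn (Searched.invariant searched)
    computation : ∀ {h σ} →
      Runs (body program) (matrix ∷ replicate 10 nil) (encodeTriples h ∷ σ) (programTime (suc m)) →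
      Computes program from matrix to encodeTriples h within (117 * ∥ matrix ∥ ^ 3)
    computation (t , ⇓τ , t≤) = _ , t , ⇓τ , refl , ≤-trans t≤ programTime≤

theorem2 : (∀ (n : ℕ) .{{_ : NonZero n}} (G : Graph n) → Tree G →
    ∀ (L : Labelling G) → TC L →
    ∀ (c : ℕ) → HasCost L c → c ≥ 2 * n ∸ 3)
    ×
    (∃[ p ] ∃[ a ] ∃[ k ]
    ∀ (n : ℕ) .{{_ : NonZero n}} (G : Graph n) → Connected G →
    ∃[ L ] HasCost {G = G} L (2 * (n ∸ 1))
    × TC L
    × (∃[ r ] (Computes p from encodeGraph G to r within (a * ∥ encodeGraph G ∥ ^ k))
    × (r Describes L)))
theorem2 = (λ n G (conn , acyclic) L tc c → cost-bound acyclic tc conn)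
         , program , 117 , 3 , λ { (suc m) G conn → computes G conn }
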